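{- For all integers $n>0$ and $k\ge 3$, there exists a necklace $u$ of length $n$ over the alphabet $\Sigma_k$ having completely unclustered Burrows--Wheeler Transform.
   Context: $\Sigma_k=\{0,1,\ldots,k-1\}$ with the usual order. The shift of a word $w=w_0\cdots w_{n-1}$ is $w_{n-1}w_0\cdots w_{n-2}$. A necklace $[w]$ is a conjugacy class of words, i.e. an equivalence class of words under iterated shift; its length is the common length $|w|$ of its words. A necklace over $\Sigma_k$ is not required to use every letter of $\Sigma_k$. The Burrows--Wheeler Transform (BWT) of a necklace $[w]$ is the word given by the last column, read top to bottom, of the matrix whose rows are the $|w|$ shifts of $w$ (counted with multiplicity) sorted in ascending lexicographic order. A necklace $u$ of length $n$ has a completely unclustered BWT if its BWT has exactly $n$ runs (maximal blocks of consecutive equal letters), i.e. no two consecutive letters of $\mathrm{BWT}(u)$ are equal (consecutive in the linear, not cyclic, sense). -}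

module Defs where

open import Data.Fin.Base using (Fin)
open import Data.Fin.Properties using (_≟_) renaming (≤-decTotalOrder to Fin-≤-decTotalOrder)
open import Data.List.Base as List using (List; []; _∷_; _++_; [_]; length; reverse; iterate; derun)
import Data.List.Properties as List
open import Data.List.Relation.Binary.Permutation.Propositional
  using (_↭_; ↭⇒↭ₛ; module PermutationReasoning)
open import Data.List.Relation.Binary.Permutation.Propositional.Properties using (∷↭∷ʳ; drop-∷)
import Data.List.Relation.Binary.Permutation.Homogeneous as Homogeneous
open import Data.List.Relation.Binary.Pointwise using (Pointwise-≡⇒≡) renaming (map to Pointwise-map)
open import Data.List.Relation.Unary.Sorted.TotalOrder.Properties using (↗↭↗⇒≋)
import Data.List.Sort.Base as Sort
import Data.List.Sort.MergeSort as MergeSort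
open import Data.Nat.Base using (ℕ; zero; suc)
open import Data.Product.Base using (_,_)
open import Data.Vec.Base as Vec using (Vec; toList; init; last; initLast)
import Data.Vec.Properties as Vec
import Data.Vec.Relation.Binary.Lex.NonStrict as Lex
open import Data.Vec.Relation.Binary.Pointwise.Inductive using () renaming (Pointwise-≡⇒≡ to Vec-Pointwise-≡⇒≡)
open import Function.Base using (_∘_)
open import Function.Bundles using (Func)
open import Level using (0ℓ)
open import Relation.Binary.Bundles using (Setoid; DecTotalOrder)
import Relation.Binary.Construct.Closure.Equivalence as Closure
open import Relation.Binary.PropositionalEquality hiding ([_])

private
  variable
    A : Set
    k n : ℕ

Word : ℕ → ℕ → Set
Word k n = Vec (Fin k) n

shift : Vec A n → Vec A n
shift {n = zero}  w = w
shift {n = suc _} w = last w Vec.∷ init w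

-- Necklaces are conjugacy classes, represented as elements of the setoid of
-- words up to conjugacy.
Necklace : ℕ → ℕ → Setoid 0ℓ 0ℓ
Necklace k n = Closure.setoid {A = Word k n} (λ v w → shift v ≡ w)

lexOrder : ℕ → ℕ → DecTotalOrder 0ℓ 0ℓ 0ℓ
lexOrder k n = Lex.≤-decTotalOrder (Fin-≤-decTotalOrder k) n

module LexSort (k n : ℕ) =
  Sort.SortingAlgorithm (MergeSort.mergeSort (lexOrder k n))

shifts : Vec A n → List (Vec A n)
shifts {n = n} w = iterate shift w n

matrix : Word k n → List (Word k n)
matrix {k} {n} w = LexSort.sort k n (shifts w)

-- A matrix with rows of length zero has no last column; this case is only
-- reached for the empty word.
lastColumn : List (Vec A n) → List A
lastColumn {n = zero}  _    = []
lastColumn {n = suc _} rows = List.map last rows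

bwt : Word k n → List (Fin k)
bwt = lastColumn ∘ matrix

private
  _^_ : (A → A) → ℕ → A → A
  (f ^ zero)  x = x
  (f ^ suc m) x = (f ^ m) (f x)

  iterate-∷ʳ : (f : A → A) (x : A) (m : ℕ) →
               iterate f x (suc m) ≡ iterate f x m List.∷ʳ (f ^ m) x
  iterate-∷ʳ f x zero    = refl
  iterate-∷ʳ f x (suc m) = cong (x ∷_) (iterate-∷ʳ f (f x) m)

  toList-shift : (w : Vec A n) (xs : List A) (x : A) →
                 toList w ≡ xs List.∷ʳ x → toList (shift w) ≡ x ∷ xs
  toList-shift {n = zero}  Vec.[] []      x ()
  toList-shift {n = zero}  Vec.[] (_ ∷ _) x ()
  toList-shift {n = suc _} w xs x eq with initLast w
  ... | ys , y , refl
    with refl , refl ← List.∷ʳ-injective (toList ys) xs (trans (sym (Vec.toList-∷ʳ y ys)) eq)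
    = refl

  toList-shift^ : (w : Vec A n) (xs ys : List A) →
                  toList w ≡ xs ++ reverse ys →
                  toList ((shift ^ length ys) w) ≡ reverse ys ++ xs
  toList-shift^ w xs []       eq = trans eq (List.++-identityʳ xs)
  toList-shift^ w xs (y ∷ ys) eq = begin
    toList ((shift ^ length ys) (shift w)) ≡⟨ toList-shift^ (shift w) (y ∷ xs) ys step ⟩
    reverse ys ++ y ∷ xs                   ≡⟨ List.++-assoc (reverse ys) [ y ] xs ⟨
    (reverse ys ++ [ y ]) ++ xs            ≡⟨ cong (_++ xs) (List.unfold-reverse y ys) ⟨
    reverse (y ∷ ys) ++ xs                 ∎
    where
    open ≡-Reasoning
    step : toList (shift w) ≡ y ∷ xs ++ reverse ys
    step = toList-shift w (xs ++ reverse ys) y (begin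
      toList w                   ≡⟨ eq ⟩
      xs ++ reverse (y ∷ ys)     ≡⟨ cong (xs ++_) (List.unfold-reverse y ys) ⟩
      xs ++ (reverse ys ++ [ y ]) ≡⟨ List.++-assoc xs (reverse ys) [ y ] ⟨
      (xs ++ reverse ys) ++ [ y ] ∎)

  shift^n : (w : Vec A n) → (shift ^ n) w ≡ w
  shift^n {n = n} w = trans (sym (Vec.cast-is-id refl _)) (Vec.toList-injective refl _ w (begin
    toList ((shift ^ n) w)         ≡⟨ cong (λ m → toList ((shift ^ m) w)) len ⟨
    toList ((shift ^ length ys) w) ≡⟨ toList-shift^ w [] ys (sym (List.reverse-involutive (toList w))) ⟩
    reverse ys ++ []               ≡⟨ List.++-identityʳ (reverse ys) ⟩
    reverse ys                     ≡⟨ List.reverse-involutive (toList w) ⟩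
    toList w                       ∎))
    where
    open ≡-Reasoning
    ys = reverse (toList w)
    len : length ys ≡ n
    len = trans (List.length-reverse (toList w)) (Vec.length-toList w)

shifts-shift : (w : Vec A n) → shifts (shift w) ↭ shifts w
shifts-shift {n = n} w = drop-∷ (begin
  w ∷ shifts (shift w)               ≡⟨ iterate-∷ʳ shift w n ⟩
  shifts w List.∷ʳ (shift ^ n) w     ≡⟨ cong (shifts w List.∷ʳ_) (shift^n w) ⟩
  shifts w List.∷ʳ w                 ↭⟨ ∷↭∷ʳ w (shifts w) ⟨
  w ∷ shifts w                       ∎)
  where open PermutationReasoning

sort-cong : {vs ws : List (Word k n)} → vs ↭ ws → LexSort.sort k n vs ≡ LexSort.sort k n ws
sort-cong {k} {n} {vs} {ws} vs↭ws =
  Pointwise-≡⇒≡ (Pointwise-map Vec-Pointwise-≡⇒≡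
    (↗↭↗⇒≋ (DecTotalOrder.totalOrder (lexOrder k n)) (sort-↗ vs) (sort-↗ ws)
      (Homogeneous.map (DecTotalOrder.Eq.reflexive (lexOrder k n)) (↭⇒↭ₛ (begin
        sort vs ↭⟨ sort-↭ vs ⟩
        vs      ↭⟨ vs↭ws ⟩
        ws      ↭⟨ sort-↭ ws ⟨
        sort ws ∎)))))
  where
  open LexSort k n
  open PermutationReasoning

bwt-shift : (w : Word k n) → bwt (shift w) ≡ bwt w
bwt-shift w = cong lastColumn (sort-cong (shifts-shift w))

BWT : (k n : ℕ) → Func (Necklace k n) (setoid (List (Fin k)))
BWT k n = record
  { to   = bwt
  ; cong = Closure.gfold isEquivalence bwt (λ { {w} refl → sym (bwt-shift w) })
  }

-- `derun` keeps exactly one letter from each maximal block of equal letters.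
runs : List (Fin k) → ℕ
runs = length ∘ derun _≟_

CompletelyUnclustered : (k n : ℕ) → Setoid.Carrier (Necklace k n) → Set
CompletelyUnclustered k n u = runs (Func.to (BWT k n) u) ≡ n

{-# OPTIONS --safe #-}

-- A word v of length n whose stable-sort permutation f (position ↦ rank) is a
-- single n-cycle is the BWT of the word v(fⁿ⁻¹ 0) ⋯ v(f 0) v(0).  So it is enough
-- to find v without equal neighbours whose f is cyclic.
--
-- Start from 012012⋯ and permute letters inside each block of three.  Doing so
-- precomposes f with a permutation ρ of that block; if the first-return
-- permutation of the block is cancelled and replaced by a 3-cycle, the three
-- positions land on one orbit and no orbit is split.  There are two 3-cycles, and
-- they place different letters last, so going through the blocks from right to
-- left one can also avoid a clash with the next block.  Finally everything is
-- connected to 0: the letter 0 of block j had rank j, which is less than 3j, and a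
-- leftover position of an incomplete last block also has a smaller rank unless
-- n = 2.
module Submission where

open import Defs
open import Data.Fin.Base as Fin using (Fin; toℕ; fromℕ<)
open import Data.Fin.Patterns using (0F; 1F; 2F)
import Data.Fin.Properties as Fin
open import Data.List.Base as List using (List; []; _∷_; length; derun; tabulate; allFin)
import Data.List.Properties as List
open import Data.List.Membership.Propositional using (_∈_)
open import Data.List.Membership.Propositional.Properties using (∈-tabulate⁺; ∈-allFin)
open import Data.List.Membership.Propositional.Properties.WithK using (unique∧set⇒bag)
open import Data.List.Relation.Binary.BagAndSetEquality using (∼bag⇒↭)
import Data.List.Relation.Binary.Permutation.Homogeneous as Homogeneous
open import Data.List.Relation.Binary.Permutation.Propositional using (_↭_; ↭⇒↭ₛ)
import Data.List.Relation.Binary.Permutation.Propositional.Properties as ↭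
open import Data.List.Relation.Binary.Pointwise using (Pointwise-≡⇒≡) renaming (map to Pointwise-map)
open import Data.List.Relation.Unary.Linked using (Linked; []; [-]; _∷_)
open import Data.List.Relation.Unary.Sorted.TotalOrder using (Sorted)
open import Data.List.Relation.Unary.Sorted.TotalOrder.Properties using (↗↭↗⇒≋)
open import Data.List.Relation.Unary.Unique.Propositional.Properties using (tabulate⁺; allFin⁺)
open import Data.Nat.Base
open import Data.Nat.Divisibility using (n∣m*n)
open import Data.Nat.DivMod
open import Data.Nat.GeneralisedArithmetic using (iterate)
open import Data.Nat.Properties
open import Data.Product.Base using (∃; _×_; _,_; proj₁; proj₂)
open import Data.Sum.Base using (_⊎_; inj₁; inj₂)
open import Data.Unit.Base using (tt)
import Data.Vec.Base as Vec
import Data.Vec.Properties as Vec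
import Data.Vec.Relation.Binary.Lex.NonStrict as Lex
open import Data.Vec.Relation.Binary.Pointwise.Inductive using () renaming (Pointwise-≡⇒≡ to Vec-Pointwise-≡⇒≡)
open import Function.Base using (_∘_; id)
open import Function.Bundles using (mk⇔)
open import Function.Definitions using (Injective)
open import Relation.Binary.Bundles using (DecTotalOrder; Setoid)
open import Relation.Binary.Core using (Rel)
open import Relation.Binary.Definitions using (tri<; tri≈; tri>)
open import Relation.Binary.PropositionalEquality
open import Relation.Nullary using (¬_; Dec; yes; no; contradiction)

private
  variable
    A B : Set
    b k n : ℕ

-- Orbits of injections

iterate-suc : (f : A → A) (x : A) (t : ℕ) → iterate f (f x) t ≡ f (iterate f x t)
iterate-suc f x zero    = refl
iterate-suc f x (suc t) = iterate-suc f (f x) t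

iterate-+ : (f : A → A) (x : A) (s t : ℕ) →
            iterate f x (s + t) ≡ iterate f (iterate f x s) t
iterate-+ f x zero    t = refl
iterate-+ f x (suc s) t = iterate-+ f (f x) s t

iterate-injective : {f : A → A} → Injective _≡_ _≡_ f →
                    ∀ t {x y} → iterate f x t ≡ iterate f y t → x ≡ y
iterate-injective inj zero    eq = eq
iterate-injective inj (suc t) eq = inj (iterate-injective inj t eq)

collision : {f : A → A} → Injective _≡_ _≡_ f →
            ∀ x s d → iterate f x s ≡ iterate f x (d + s) → iterate f x d ≡ x
collision {f = f} inj x s d eq = sym (iterate-injective inj s (trans eq (iterate-+ f x d s)))

gap : ∀ {s t} → s < t → ∃ λ d → t ≡ suc d + s
gap {s} {t} s<t with d , refl ← m≤n⇒∃[o]m+o≡n s<t = d , cong suc (+-comm s d)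

abstract

  -- Two of the `n + 1` points met in the first `n` steps from `x` coincide, and injectivity cancels
  -- the steps that they share. The bound `suc d ≤ n` later pins the period of a one-orbit
  -- permutation to exactly `n`.
  period : {f : Fin n → Fin n} → Injective _≡_ _≡_ f →
           ∀ x → ∃ λ d → suc d ≤ n × iterate f x (suc d) ≡ x
  period {n} {f} inj x
    with i , j , i<j , eq ← Fin.pigeonhole (n<1+n n) (iterate f x ∘ toℕ)
    with d , j≡ ← gap i<j
    = d , ≤-trans (m≤m+n (suc d) (toℕ i)) (subst (_≤ n) j≡ (Fin.toℕ≤pred[n] j))
        , collision inj x (toℕ i) (suc d) (trans eq (cong (iterate f x) j≡))

  injective⇒surjective : {f : Fin n → Fin n} → Injective _≡_ _≡_ f → ∀ y → ∃ λ x → f x ≡ y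
  injective⇒surjective {f = f} inj y with d , _ , eq ← period inj y
    = iterate f y d , trans (sym (iterate-suc f y d)) eq

Reach : (A → A) → A → A → Set
Reach f x y = ∃ λ t → iterate f x t ≡ y

module _ {f : A → A} where

  reach-refl : ∀ {x} → Reach f x x
  reach-refl = 0 , refl

  reach-trans : ∀ {x y z} → Reach f x y → Reach f y z → Reach f x z
  reach-trans {x} (s , refl) (t , refl) = s + t , iterate-+ f x s t

  reach-step : ∀ {x y} → f x ≡ y → Reach f x y
  reach-step eq = 1 , eq

reach-mono : {f g : A → A} → (∀ x → Reach g x (f x)) →
             ∀ {x y} → Reach f x y → Reach g x y
reach-mono h {x} (zero  , refl) = reach-refl
reach-mono h {x} (suc t , eq)   = reach-trans (h x) (reach-mono h (t , eq))

-- A single step is undone by walking on round the cycle of the point it started from.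
reach-sym : {f : Fin n → Fin n} → Injective _≡_ _≡_ f →
            ∀ {x y} → Reach f x y → Reach f y x
reach-sym {f = f} inj (t , refl) = back t
  where
  back : ∀ t {x} → Reach f (iterate f x t) x
  back zero    = reach-refl
  back (suc t) {x} with d , _ , eq ← period inj x = reach-trans (back t) (d , eq)

-- Rerouting a permutation through a block of points

module Block {f : Fin n → Fin n} (f-inj : Injective _≡_ _≡_ f)
             {p : Fin b → Fin n} (p-inj : Injective _≡_ _≡_ p) where

  Inside : Fin n → Set
  Inside x = ∃ λ s → x ≡ p s

  -- The forward orbit of `x` first hits the block at `p s`, zero steps being allowed. A first
  -- return of `p c` is therefore an entrance from `f (p c)`.
  data Enters : Fin n → Fin b → Set where
    here  : ∀ {x s} → x ≡ p s → Enters x s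
    there : ∀ {x s} → ¬ Inside x → Enters (f x) s → Enters x s

  enters-unique : ∀ {x s s′} → Enters x s → Enters x s′ → s ≡ s′
  enters-unique (here eq)     (here eq′)     = p-inj (trans (sym eq) eq′)
  enters-unique (here eq)     (there x∉ _)   = contradiction (_ , eq) x∉
  enters-unique (there x∉ _)  (here eq′)     = contradiction (_ , eq′) x∉
  enters-unique (there _ es)  (there _ es′)  = enters-unique es es′

  private
    -- Cut a path ending at p s after its last earlier visit to the block.
    last-exit : ∀ t {x s} → iterate f x t ≡ p s →
                Enters x s ⊎ ∃ λ c → Enters (f (p c)) s
    last-exit zero    eq = inj₁ (here eq)
    last-exit (suc t) {x} eq with last-exit t eq
    ... | inj₂ found = inj₂ found
    ... | inj₁ enters with Fin.any? (λ s → x Fin.≟ p s)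
    ...   | yes (c , refl) = inj₂ (c , enters)
    ...   | no  x∉         = inj₁ (there x∉ enters)

    abstract
      entrance : ∀ s → ∃ λ c → Enters (f (p c)) s
      -- The cycle of `p s` is followed from `f (p s)` on. If no block point is met on the way,
      -- `p s` is its own predecessor.
      entrance s with d , _ , eq ← period f-inj (p s) with last-exit d eq
      ... | inj₁ enters = s , enters
      ... | inj₂ found  = found

  -- The inverse of the first-return permutation of the block.
  pred-return : Fin b → Fin b
  pred-return s = proj₁ (entrance s)

  pred-return-enters : ∀ s → Enters (f (p (pred-return s))) s
  pred-return-enters s = proj₂ (entrance s)

  -- A block point determines where it first returns, so `s` can be recovered from its predecessor.
  pred-return-injective : Injective _≡_ _≡_ pred-return
  pred-return-injective {s} {s′} eq = enters-unique (pred-return-enters s)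
    (subst (λ c → Enters (f (p c)) s′) (sym eq) (pred-return-enters s′))

  -- From `p s` the map `g` continues as `f` does from the predecessor of `p (r s)`, so it next
  -- meets the block at `p (r s)`. The first-return map of `g` is thus `r`, whatever that of `f`
  -- was.
  module Rewire {r : Fin b → Fin b} (r-inj : Injective _≡_ _≡_ r)
                (r-cycle : ∀ s s′ → Reach r s s′)
                {g : Fin n → Fin n}
                (outside : ∀ x → ¬ Inside x → g x ≡ f x)
                (inside : ∀ s → g (p s) ≡ f (p (pred-return (r s)))) where

    private
      enters⇒reach : ∀ {x s} → Enters x s → Reach g x (p s)
      enters⇒reach (here refl)    = reach-refl
      enters⇒reach (there x∉ es)  = reach-trans (reach-step (outside _ x∉)) (enters⇒reach es)

      along : ∀ s t → Reach g (p s) (p (iterate r s t))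
      along s zero    = reach-refl
      along s (suc t) = reach-trans
        (reach-trans (reach-step (inside s)) (enters⇒reach (pred-return-enters (r s))))
        (along (r s) t)

    merged : ∀ s s′ → Reach g (p s) (p s′)
    merged s s′ with t , refl ← r-cycle s s′ = along s t

    -- Only steps out of block points change. The value `f (p c)` is now taken by `g` at some block
    -- point `p s`, and `merged` leads from `p c` to that point.
    preserved : ∀ {x y} → Reach f x y → Reach g x y
    preserved = reach-mono step
      where
      step : ∀ x → Reach g x (f x)
      step x with Fin.any? (λ s → x Fin.≟ p s)
      ... | no  x∉ = reach-step (outside x x∉)
      ... | yes (c , refl)
        with s , eq ← injective⇒surjective (r-inj ∘ pred-return-injective) c
        = reach-trans (merged c s) (reach-step (trans (inside s) (cong (f ∘ p) eq)))

-- Inverting the Burrows–Wheeler transform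

tabulate-linked : ∀ {ℓ} {R : Rel A ℓ} {f : Fin n → A} →
                  (∀ i j → toℕ j ≡ suc (toℕ i) → R (f i) (f j)) → Linked R (tabulate f)
tabulate-linked {n = zero}        adj = []
tabulate-linked {n = suc zero}    adj = [-]
tabulate-linked {n = suc (suc _)} adj =
  adj 0F 1F refl ∷
  tabulate-linked (λ i j eq → adj (Fin.suc i) (Fin.suc j) (cong suc eq))

iterate-tabulate : (f : A → A) (x : A) (m : ℕ) →
                   List.iterate f x m ≡ tabulate {n = m} (iterate f x ∘ toℕ)
iterate-tabulate f x zero    = refl
iterate-tabulate f x (suc m) = cong (x ∷_) (iterate-tabulate f (f x) m)

iterate-map : {f : A → A} {g : B → B} (h : A → B) → (∀ x → g (h x) ≡ h (f x)) →
              ∀ x m → List.iterate g (h x) m ≡ List.map h (List.iterate f x m)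
iterate-map h comm x zero    = refl
iterate-map {f = f} {g} h comm x (suc m) = cong (h x ∷_)
  (trans (cong (λ y → List.iterate g y m) (comm x)) (iterate-map h comm (f x) m))

derun-linked : {xs : List (Fin k)} → Linked _≢_ xs → derun Fin._≟_ xs ≡ xs
derun-linked []              = refl
derun-linked [-]             = refl
derun-linked (_∷_ {x} {_} {xs} x≢y linked) =
  trans (List.derun-accept Fin._≟_ xs x≢y) (cong (x ∷_) (derun-linked linked))

sort-sorted : {ws : List (Word k n)} → Sorted (DecTotalOrder.totalOrder (lexOrder k n)) ws →
              LexSort.sort k n ws ≡ ws
sort-sorted {k} {n} {ws} ws↗ = Pointwise-≡⇒≡ (Pointwise-map Vec-Pointwise-≡⇒≡
  (↗↭↗⇒≋ (DecTotalOrder.totalOrder (lexOrder k n)) (sort-↗ ws) ws↗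
    (Homogeneous.map (DecTotalOrder.Eq.reflexive (lexOrder k n)) (↭⇒↭ₛ (sort-↭ ws)))))
  where open LexSort k n

-- Permutations with a single orbit

module Cyclic {f : Fin n → Fin n} (f-inj : Injective _≡_ _≡_ f)
              {z : Fin n} (covers : ∀ x → Reach f z x) where

  private
    residue : ∀ {d} .{{_ : NonZero d}} → iterate f z d ≡ z →
              ∀ t → iterate f z (t % d) ≡ iterate f z t
    residue {d} eq t = begin
      iterate f z (t % d)                             ≡⟨ cong (λ x → iterate f x (t % d)) (multiple (t / d)) ⟨
      iterate f (iterate f z (t / d * d)) (t % d)     ≡⟨ iterate-+ f z (t / d * d) (t % d) ⟨
      iterate f z (t / d * d + t % d)                 ≡⟨ cong (iterate f z) (+-comm (t / d * d) (t % d)) ⟩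
      iterate f z (t % d + t / d * d)                 ≡⟨ cong (iterate f z) (m≡m%n+[m/n]*n t d) ⟨
      iterate f z t                                   ∎
      where
      open ≡-Reasoning
      multiple : ∀ q → iterate f z (q * d) ≡ z
      multiple zero    = refl
      multiple (suc q) = trans (iterate-+ f z d (q * d))
        (trans (cong (λ x → iterate f x (q * d)) eq) (multiple q))

    -- Arrival times can be reduced modulo `d`, which gives each of the `n` points its own time
    -- below `d`.
    n≤period : ∀ {d} .{{_ : NonZero d}} → iterate f z d ≡ z → n ≤ d
    n≤period {d} eq = Fin.injective⇒≤ {f = time} time-inj
      where
      time : Fin n → Fin d
      time x = fromℕ< (m%n<n (proj₁ (covers x)) d)

      back : ∀ x → iterate f z (toℕ (time x)) ≡ x
      back x = trans (cong (iterate f z) (Fin.toℕ-fromℕ< (m%n<n (proj₁ (covers x)) d)))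
        (trans (residue eq (proj₁ (covers x))) (proj₂ (covers x)))

      time-inj : Injective _≡_ _≡_ time
      time-inj {x} {y} tx≡ty =
        trans (sym (back x)) (trans (cong (iterate f z ∘ toℕ) tx≡ty) (back y))

    iterate-period : iterate f z n ≡ z
    iterate-period with d , d<n , eq ← period f-inj z =
      subst (λ m → iterate f z m ≡ z) (≤-antisym d<n (n≤period eq)) eq

  iterate-full : ∀ x → iterate f x n ≡ x
  iterate-full x with t , refl ← covers x = begin
    iterate f (iterate f z t) n ≡⟨ iterate-+ f z t n ⟨
    iterate f z (t + n)         ≡⟨ cong (iterate f z) (+-comm t n) ⟩
    iterate f z (n + t)         ≡⟨ iterate-+ f z n t ⟩
    iterate f (iterate f z n) t ≡⟨ cong (λ y → iterate f y t) iterate-period ⟩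
    iterate f z t               ∎
    where open ≡-Reasoning

  private
    no-collision : ∀ {s t} → s < t → t < n → iterate f z s ≢ iterate f z t
    no-collision {s} {t} s<t t<n eq with d , refl ← gap s<t =
      <⇒≱ (≤-<-trans (m≤m+n (suc d) s) t<n) (n≤period (collision f-inj z s (suc d) eq))

    orbit-injective : Injective _≡_ _≡_ (iterate f z ∘ toℕ {n})
    orbit-injective {i} {j} eq with Fin.<-cmp i j
    ... | tri< i<j _ _ = contradiction eq (no-collision i<j (Fin.toℕ<n j))
    ... | tri≈ _ i≡j _ = i≡j
    ... | tri> _ _ j<i = contradiction (sym eq) (no-collision j<i (Fin.toℕ<n i))

  orbit↭allFin : List.iterate f z n ↭ allFin n
  orbit↭allFin rewrite iterate-tabulate f z n =
    ∼bag⇒↭ (unique∧set⇒bag (tabulate⁺ orbit-injective) (allFin⁺ n)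
      (mk⇔ (λ _ → ∈-allFin _) (λ _ → in-orbit _)))
    where
    in-orbit : ∀ x → x ∈ tabulate (iterate f z ∘ toℕ)
    in-orbit x with i , refl ← injective⇒surjective orbit-injective x = ∈-tabulate⁺ i

-- The letter v i is moved by f to its rank under the stable sort of v.
StandardPermutation : (Fin n → Fin k) → (Fin n → Fin n) → Set
StandardPermutation v f = ∀ i j → v i Fin.< v j ⊎ (v i ≡ v j × i Fin.< j) → f i Fin.< f j

-- Recovering the matrix of shifts from its last column

module Inversion {v : Fin n → Fin k} {f : Fin n → Fin n} (std : StandardPermutation v f) where

  reflects-< : ∀ i j → f i Fin.< f j → v i Fin.< v j ⊎ (v i ≡ v j × i Fin.< j)
  reflects-< i j fi<fj with Fin.<-cmp (v i) (v j) | Fin.<-cmp i j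
  ... | tri< vi<vj _ _ | _            = inj₁ vi<vj
  ... | tri≈ _ vi≡vj _ | tri< i<j _ _ = inj₂ (vi≡vj , i<j)
  ... | tri≈ _ _ _     | tri≈ _ refl _ = contradiction fi<fj (Fin.<-irrefl refl)
  ... | tri≈ _ vi≡vj _ | tri> _ _ j<i = contradiction (std j i (inj₂ (sym vi≡vj , j<i))) (Fin.<-asym fi<fj)
  ... | tri> _ _ vj<vi | _            = contradiction (std j i (inj₁ vj<vi)) (Fin.<-asym fi<fj)

  injective : Injective _≡_ _≡_ f
  injective {i} {j} eq with Fin.<-cmp (v i) (v j) | Fin.<-cmp i j
  ... | tri< vi<vj _ _ | _             = contradiction (std i j (inj₁ vi<vj)) (Fin.<-irrefl eq)
  ... | tri≈ _ vi≡vj _ | tri< i<j _ _  = contradiction (std i j (inj₂ (vi≡vj , i<j))) (Fin.<-irrefl eq)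
  ... | tri≈ _ _ _     | tri≈ _ i≡j _ = i≡j
  ... | tri≈ _ vi≡vj _ | tri> _ _ j<i  = contradiction (std j i (inj₂ (sym vi≡vj , j<i))) (Fin.<-irrefl (sym eq))
  ... | tri> _ _ vj<vi | _             = contradiction (std j i (inj₁ vj<vi)) (Fin.<-irrefl (sym eq))

  -- The orbit of `i` is read backwards, so that the last letter is `v i` and the last column of the
  -- rows is `v`. The lexicographic order needs the view from the front, given by `row-∷`.
  row : (t : ℕ) → Fin n → Word k t
  row zero    i = Vec.[]
  row (suc t) i = row t (f i) Vec.∷ʳ v i

  row-∷ : ∀ t i → row (suc t) i ≡ v (iterate f i t) Vec.∷ row t i
  row-∷ zero    i = refl
  row-∷ (suc t) i = cong (Vec._∷ʳ v i) (row-∷ t (f i))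

  -- By `reflects-<`, an order between the end points comes from their predecessors: either the
  -- letters there, which are the first letters of the rows, already differ, or the order passes to
  -- the predecessors and the comparison moves on. When all orbits close up after `t` steps, the end
  -- points are `i` and `j` themselves.
  row-sorted : ∀ t i j → iterate f i t Fin.≤ iterate f j t →
               DecTotalOrder._≤_ (lexOrder k t) (row t i) (row t j)
  row-sorted t i j le with m≤n⇒m<n∨m≡n le
  ... | inj₂ eq = DecTotalOrder.reflexive (lexOrder k t)
    (DecTotalOrder.Eq.reflexive (lexOrder k t)
      (cong (row t) (iterate-injective injective t (Fin.toℕ-injective eq))))
  ... | inj₁ lt = strict t i j lt
    where
    strict : ∀ t i j → iterate f i t Fin.< iterate f j t →
             DecTotalOrder._≤_ (lexOrder k t) (row t i) (row t j)
    strict zero    i j lt = Lex.base tt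
    strict (suc t) i j lt
      rewrite row-∷ t i | row-∷ t j | iterate-suc f i t | iterate-suc f j t
      with reflects-< _ _ lt
    ... | inj₁ v<v         = Lex.this (<⇒≤ v<v , Fin.<⇒≢ v<v) refl
    ... | inj₂ (v≡v , lt′) = Lex.next v≡v (strict t i j lt′)

  -- Shifting brings `v i` to the front, and `row t (f i)` starts with this letter once the orbit
  -- closes up after `t` steps.
  shift-row : ∀ {t} i → iterate f i t ≡ i → shift (row t i) ≡ row t (f i)
  shift-row {zero}  i eq = refl
  shift-row {suc t} i eq = begin
    Vec.last (row t (f i) Vec.∷ʳ v i) Vec.∷ Vec.init (row t (f i) Vec.∷ʳ v i)
      ≡⟨ cong₂ Vec._∷_ (Vec.last-∷ʳ (v i) (row t (f i))) (Vec.init-∷ʳ (v i) (row t (f i))) ⟩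
    v i Vec.∷ row t (f i)                     ≡⟨ cong (λ x → v x Vec.∷ row t (f i)) eq ⟨
    v (iterate f (f i) t) Vec.∷ row t (f i)   ≡⟨ row-∷ t (f i) ⟨
    row (suc t) (f i)                         ∎
    where open ≡-Reasoning

  lastColumn-rows : ∀ {t} .{{_ : NonZero t}} (is : List (Fin n)) →
                    lastColumn (List.map (row t) is) ≡ List.map v is
  lastColumn-rows {suc t} is = trans (sym (List.map-∘ is))
    (List.map-cong (λ i → Vec.last-∷ʳ (v i) (row t (f i))) is)

  module _ {z : Fin n} (covers : ∀ x → Reach f z x) where

    open Cyclic injective covers

    -- The shifts of `row n z` are the rows along the orbit of `z`, hence all rows once each, and
    -- these are sorted when listed by index.
    matrix-row : matrix (row n z) ≡ tabulate (row n)
    matrix-row = begin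
      sort (List.iterate shift (row n z) n)
        ≡⟨ cong sort (iterate-map (row n) (λ x → shift-row x (iterate-full x)) z n) ⟩
      sort (List.map (row n) (List.iterate f z n)) ≡⟨ sort-cong (↭.map⁺ (row n) orbit↭allFin) ⟩
      sort (List.map (row n) (allFin n))           ≡⟨ cong sort (List.map-tabulate id (row n)) ⟩
      sort (tabulate (row n))                      ≡⟨ sort-sorted (tabulate-linked sorted) ⟩
      tabulate (row n)                             ∎
      where
      open ≡-Reasoning
      open LexSort k n using (sort)
      sorted : ∀ i j → toℕ j ≡ suc (toℕ i) → DecTotalOrder._≤_ (lexOrder k n) (row n i) (row n j)
      sorted i j eq = row-sorted n i j
        (subst₂ Fin._≤_ (sym (iterate-full i)) (sym (iterate-full j)) (<⇒≤ (≤-reflexive (sym eq))))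

    bwt-row : .{{_ : NonZero n}} → bwt (row n z) ≡ tabulate v
    bwt-row = begin
      lastColumn (matrix (row n z))              ≡⟨ cong lastColumn matrix-row ⟩
      lastColumn (tabulate (row n))              ≡⟨ cong lastColumn (List.map-tabulate id (row n)) ⟨
      lastColumn (List.map (row n) (allFin n))   ≡⟨ lastColumn-rows (allFin n) ⟩
      List.map v (allFin n)                      ≡⟨ List.map-tabulate id v ⟩
      tabulate v                                 ∎
      where open ≡-Reasoning

    unclustered : .{{_ : NonZero n}} → (∀ i j → toℕ j ≡ suc (toℕ i) → v i ≢ v j) →
                  CompletelyUnclustered k n (row n z)
    unclustered adj = begin
      runs (bwt (row n z)) ≡⟨ cong runs bwt-row ⟩
      runs (tabulate v)    ≡⟨ cong length (derun-linked (tabulate-linked adj)) ⟩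
      length (tabulate v)  ≡⟨ List.length-tabulate v ⟩
      n                    ∎
      where open ≡-Reasoning

-- Permuting the letters of 012012⋯ within blocks

⌈_/3⌉ : ℕ → ℕ
⌈ 0 /3⌉                 = 0
⌈ 1 /3⌉                 = 1
⌈ 2 /3⌉                 = 1
⌈ suc (suc (suc m)) /3⌉ = suc ⌈ m /3⌉

-- The summands count the residue classes modulo 3. Adding one position rotates them and increases
-- one by 1.
⌈/3⌉-sum : ∀ m → ⌈ 2 + m /3⌉ + ⌈ 1 + m /3⌉ + ⌈ m /3⌉ ≡ 2 + m
⌈/3⌉-sum zero    = refl
⌈/3⌉-sum (suc m) = cong suc (begin
  ⌈ m /3⌉ + ⌈ 2 + m /3⌉ + ⌈ 1 + m /3⌉   ≡⟨ +-assoc ⌈ m /3⌉ _ _ ⟩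
  ⌈ m /3⌉ + (⌈ 2 + m /3⌉ + ⌈ 1 + m /3⌉) ≡⟨ +-comm ⌈ m /3⌉ _ ⟩
  ⌈ 2 + m /3⌉ + ⌈ 1 + m /3⌉ + ⌈ m /3⌉   ≡⟨ ⌈/3⌉-sum m ⟩
  2 + m                                 ∎)
  where open ≡-Reasoning

*3<⇒<⌈/3⌉ : ∀ q {m} → q * 3 < m → q < ⌈ m /3⌉
*3<⇒<⌈/3⌉ zero    {1}                 _ = z<s
*3<⇒<⌈/3⌉ zero    {2}                 _ = z<s
*3<⇒<⌈/3⌉ zero    {suc (suc (suc m))} _ = z<s
*3<⇒<⌈/3⌉ (suc q) {suc (suc (suc m))} (s<s (s<s (s<s lt))) = s<s (*3<⇒<⌈/3⌉ q lt)

⌈[2+q*3]/3⌉ : ∀ q → ⌈ 2 + q * 3 /3⌉ ≡ suc q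
⌈[2+q*3]/3⌉ zero    = refl
⌈[2+q*3]/3⌉ (suc q) = cong suc (⌈[2+q*3]/3⌉ q)

[s+q*3]/3 : ∀ {s} q → s < 3 → (s + q * 3) / 3 ≡ q
[s+q*3]/3 {s} q s<3 = trans (+-distrib-/-∣ʳ s (n∣m*n q))
  (cong₂ _+_ (m<n⇒m/n≡0 s<3) (m*n/n≡m q 3))

[s+q*3]%3 : ∀ {s} q → s < 3 → (s + q * 3) % 3 ≡ s
[s+q*3]%3 {s} q s<3 = trans ([m+kn]%n≡m%n s q 3) (m<n⇒m%n≡m s<3)

-- The number of i < n with i % 3 < c, for c ≤ 3.
offset : ℕ → ℕ → ℕ
offset n zero    = 0
offset n (suc c) = offset n c + ⌈ n ∸ c /3⌉

offset-3 : ∀ n → offset n 3 ≡ n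
offset-3 zero          = refl
offset-3 (suc zero)    = refl
offset-3 (suc (suc m)) = ⌈/3⌉-sum m

offset-mono : ∀ n {c d} → c ≤′ d → offset n c ≤ offset n d
offset-mono n ≤′-refl         = ≤-refl
offset-mono n (≤′-step c≤′d) = ≤-trans (offset-mono n c≤′d) (m≤m+n _ _)

-- Stable-sort rank of position `i` in 012012⋯ cut at `n`: all smaller letters come before it, and
-- so do the `i / 3` earlier copies of its own letter.
rank : ℕ → ℕ → ℕ
rank n i = offset n (i % 3) + i / 3

rank<offset : ∀ {n i} → i < n → rank n i < offset n (suc (i % 3))
rank<offset {n} {i} i<n = +-monoʳ-< (offset n (i % 3)) (*3<⇒<⌈/3⌉ (i / 3)
  (m+n≤o⇒m≤o∸n (suc (i / 3 * 3))
    (subst (_< n) (trans (m≡m%n+[m/n]*n i 3) (+-comm (i % 3) (i / 3 * 3))) i<n)))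

rank< : ∀ {n i} → i < n → rank n i < n
rank< {n} {i} i<n = subst (rank n i <_) (offset-3 n)
  (<-≤-trans (rank<offset i<n) (offset-mono n (≤⇒≤′ (m%n<n i 3))))

rank-mono-slot : ∀ {n} i j → i < n → i % 3 < j % 3 → rank n i < rank n j
rank-mono-slot {n} i j i<n i<j =
  <-≤-trans (rank<offset i<n) (≤-trans (offset-mono n (≤⇒≤′ i<j)) (m≤m+n _ _))

rank-mono-block : ∀ {n} i j → i % 3 ≡ j % 3 → i / 3 < j / 3 → rank n i < rank n j
rank-mono-block {n} i j i≡j i<j rewrite i≡j = +-monoʳ-< (offset n (j % 3)) i<j

-- Only positions in an incomplete last block need to descend on their own.
rank-descends : ∀ {n i} → n ≢ 2 → i < n → 0 < i → n ≤ 2 + i / 3 * 3 → rank n i < i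
rank-descends {n} {i} n≢2 i<n 0<i short
  with i % 3 | i / 3 | m%n<n i 3 | m≡m%n+[m/n]*n i 3
... | 0 | zero  | _ | refl = contradiction 0<i λ ()
... | 0 | suc q | _ | refl = s<s (s≤s (≤-trans (m≤m*n q 3) (n≤1+n (q * 3))))
-- The two bounds force `n = 2 + 3q`. The rank is then `2q + 1` and the position `3q + 1`, which
-- agree only for `q = 0`, that is `n = 2`.
... | 1 | q     | _ | refl with refl ← ≤-antisym i<n short with q
...   | zero   = contradiction refl n≢2
...   | suc q′ rewrite ⌈[2+q*3]/3⌉ q′ = s<s (s<s (s≤s (begin
  q′ + suc q′      ≡⟨ +-suc q′ q′ ⟩
  suc (q′ + q′)    ≤⟨ s≤s (+-monoʳ-≤ q′ (m≤m+n q′ (q′ + 0))) ⟩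
  suc (3 * q′)     ≡⟨ cong suc (*-comm 3 q′) ⟩
  suc (q′ * 3)     ∎)))
  where open ≤-Reasoning
rank-descends n≢2 i<n 0<i short | 2 | q | _ | refl = contradiction short (<⇒≱ i<n)
rank-descends n≢2 i<n 0<i short | suc (suc (suc _)) | q | s≤s (s≤s (s≤s ())) | _

next next² : Fin 3 → Fin 3
next 0F = 1F
next 1F = 2F
next 2F = 0F
next² = next ∘ next

next³ : ∀ s → next (next² s) ≡ s
next³ 0F = refl
next³ 1F = refl
next³ 2F = refl

next-injective : Injective _≡_ _≡_ next
next-injective {s} {s′} eq = trans (sym (next³ s)) (trans (cong next² eq) (next³ s′))

next-cycle : ∀ s s′ → Reach next s s′
next-cycle s s′ = reach-trans (reach-sym next-injective (from-0 s)) (from-0 s′)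
  where
  from-0 : ∀ s → Reach next 0F s
  from-0 0F = 0 , refl
  from-0 1F = 1 , refl
  from-0 2F = 2 , refl

next²-cycle : ∀ s s′ → Reach next² s s′
next²-cycle s s′ = reach-mono (λ x → 2 , next³ (next x)) (next-cycle s s′)

-- Sweeping through the blocks from right to left

module Arrangements (n k : ℕ) (3≤k : 3 ≤ k) where

  block : Fin n → ℕ
  block x = toℕ x / 3

  slot : Fin n → Fin 3
  slot x = fromℕ< (m%n<n (toℕ x) 3)

  letter : Fin n → Fin k
  letter x = Fin.inject≤ (slot x) 3≤k

  f₀ : Fin n → Fin n
  f₀ x = fromℕ< (rank< (Fin.toℕ<n x))

  toℕ-letter : ∀ x → toℕ (letter x) ≡ toℕ x % 3
  toℕ-letter x = trans (Fin.toℕ-inject≤ (slot x) 3≤k) (Fin.toℕ-fromℕ< _)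

  toℕ-f₀ : ∀ x → toℕ (f₀ x) ≡ rank n (toℕ x)
  toℕ-f₀ x = Fin.toℕ-fromℕ< _

  same-slot : ∀ x y → letter x ≡ letter y → toℕ x % 3 ≡ toℕ y % 3
  same-slot x y lx≡ly = trans (sym (toℕ-letter x)) (trans (cong toℕ lx≡ly) (toℕ-letter y))

  letter-block-injective : ∀ {x y} → letter x ≡ letter y → block x ≡ block y → x ≡ y
  letter-block-injective {x} {y} lx≡ly bx≡by = Fin.toℕ-injective (begin
    toℕ x                   ≡⟨ m≡m%n+[m/n]*n (toℕ x) 3 ⟩
    toℕ x % 3 + block x * 3 ≡⟨ cong₂ (λ s q → s + q * 3) (same-slot x y lx≡ly) bx≡by ⟩
    toℕ y % 3 + block y * 3 ≡⟨ m≡m%n+[m/n]*n (toℕ y) 3 ⟨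
    toℕ y                   ∎)
    where
    open ≡-Reasoning

  standard₀ : StandardPermutation letter f₀
  standard₀ x y lex = subst₂ _<_ (sym (toℕ-f₀ x)) (sym (toℕ-f₀ y)) (rank-< lex)
    where
    rank-< : letter x Fin.< letter y ⊎ (letter x ≡ letter y × x Fin.< y) →
             rank n (toℕ x) < rank n (toℕ y)
    rank-< (inj₁ lx<ly) = rank-mono-slot (toℕ x) (toℕ y) (Fin.toℕ<n x)
      (subst₂ _<_ (toℕ-letter x) (toℕ-letter y) lx<ly)
    rank-< (inj₂ (lx≡ly , x<y)) = rank-mono-block (toℕ x) (toℕ y) (same-slot x y lx≡ly)
      (≤∧≢⇒< (/-monoˡ-≤ 3 (<⇒≤ x<y)) (Fin.<⇒≢ x<y ∘ letter-block-injective lx≡ly))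

  block-boundary : ∀ {x y} → toℕ y ≡ suc (toℕ x) → block x ≢ block y →
                   toℕ x ≡ 2 + block x * 3
  block-boundary {x} {y} y≡1+x bx≢by
    with toℕ x % 3 | m%n<n (toℕ x) 3 | m≡m%n+[m/n]*n (toℕ x) 3
  ... | 0 | _ | eq = contradiction
    (sym (trans (cong (_/ 3) (trans y≡1+x (cong suc eq))) ([s+q*3]/3 (block x) (s<s z<s)))) bx≢by
  ... | 1 | _ | eq = contradiction
    (sym (trans (cong (_/ 3) (trans y≡1+x (cong suc eq))) ([s+q*3]/3 (block x) (s<s (s<s z<s))))) bx≢by
  ... | 2 | _ | eq = eq
  ... | suc (suc (suc _)) | s≤s (s≤s (s≤s ())) | _

  -- The invariant of the sweep once the blocks from `j` on are treated. The condition
  -- `2 + block x * 3 < n` says that the block of `x` is complete.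
  record Arrangement (j : ℕ) : Set where
    field
      ρ           : Fin n → Fin n
      ρ-injective : Injective _≡_ _≡_ ρ
      ρ-block     : ∀ x → block (ρ x) ≡ block x
      preserved   : ∀ {x y} → Reach f₀ x y → Reach (f₀ ∘ ρ) x y
      merged      : ∀ {x y} → block x ≡ block y → j ≤ block x → 2 + block x * 3 < n →
                    Reach (f₀ ∘ ρ) x y
      separated   : ∀ {x y} → toℕ y ≡ suc (toℕ x) → block x ≢ block y → j ≤ block x →
                    letter (ρ x) ≢ letter (ρ y)

  module Step {j : ℕ} (arr : Arrangement (suc j)) (full : 2 + j * 3 < n) where

    open Arrangement arr

    p : Fin 3 → Fin n
    p s = fromℕ< (≤-<-trans (+-monoˡ-≤ (j * 3) (Fin.toℕ≤pred[n] s)) full)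

    toℕ-p : ∀ s → toℕ (p s) ≡ toℕ s + j * 3
    toℕ-p s = Fin.toℕ-fromℕ< _

    p-injective : Injective _≡_ _≡_ p
    p-injective {s} {s′} eq = Fin.toℕ-injective (+-cancelʳ-≡ (j * 3) (toℕ s) (toℕ s′)
      (trans (sym (toℕ-p s)) (trans (cong toℕ eq) (toℕ-p s′))))

    block-p : ∀ s → block (p s) ≡ j
    block-p s = trans (cong (_/ 3) (toℕ-p s)) ([s+q*3]/3 j (Fin.toℕ<n s))

    slot-p : ∀ s → slot (p s) ≡ s
    slot-p s = Fin.toℕ-injective (trans (Fin.toℕ-fromℕ< _)
      (trans (cong (_% 3) (toℕ-p s)) ([s+q*3]%3 j (Fin.toℕ<n s))))

    p-slot : ∀ x → block x ≡ j → x ≡ p (slot x)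
    p-slot x refl = Fin.toℕ-injective (begin
      toℕ x                   ≡⟨ m≡m%n+[m/n]*n (toℕ x) 3 ⟩
      toℕ x % 3 + j * 3       ≡⟨ cong (_+ j * 3) (Fin.toℕ-fromℕ< (m%n<n (toℕ x) 3)) ⟨
      toℕ (slot x) + j * 3    ≡⟨ toℕ-p (slot x) ⟨
      toℕ (p (slot x))        ∎)
      where open ≡-Reasoning

    open Block {f = f₀ ∘ ρ} (ρ-injective ∘ Inversion.injective standard₀) p-injective

    block-ρ-p : ∀ s → block (ρ (p s)) ≡ j
    block-ρ-p s = trans (ρ-block (p s)) (block-p s)

    -- Slot 2 goes to 0 under `next` and to 1 under `next²`. The two choices thus put different
    -- letters of the block last, and at most one of these equals the letter that follows.
    -- Quantifying over `y` also covers a block that ends the word.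
    clash-free-cycle : ∃ λ (r : Fin 3 → Fin 3) → Injective _≡_ _≡_ r × (∀ s s′ → Reach r s s′) ×
             (∀ y → toℕ y ≡ 3 + j * 3 →
                letter (ρ (p (pred-return (r 2F)))) ≢ letter (ρ y))
    clash-free-cycle with 3 + j * 3 <? n
    ... | no  ≮n = next , next-injective , next-cycle ,
      λ y eq → contradiction (subst (_< n) eq (Fin.toℕ<n y)) ≮n
    ... | yes <n with letter (ρ (p (pred-return 0F))) Fin.≟ letter (ρ (fromℕ< <n))
    ...   | no  ≢₀ = next , next-injective , next-cycle , λ y eq →
      subst (λ y → _ ≢ letter (ρ y)) (Fin.toℕ-injective (trans (Fin.toℕ-fromℕ< <n) (sym eq))) ≢₀
    ...   | yes ≡₀ = next² , next-injective ∘ next-injective , next²-cycle , λ y eq ≡₁ →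
      contradiction
        (pred-return-injective (p-injective (ρ-injective (letter-block-injective
          (trans ≡₁ (trans (cong (letter ∘ ρ) (Fin.toℕ-injective (trans eq (sym (Fin.toℕ-fromℕ< <n))))) (sym ≡₀)))
          (trans (block-ρ-p (pred-return 1F)) (sym (block-ρ-p (pred-return 0F))))))))
        λ ()

    r : Fin 3 → Fin 3
    r = proj₁ clash-free-cycle

    r-injective : Injective _≡_ _≡_ r
    r-injective = proj₁ (proj₂ clash-free-cycle)

    -- Precomposing with `τ` yields the map `g` of `Rewire`: `pred-return` cancels the old
    -- first-return permutation of block `j`, and `r` replaces it.
    τ : Fin n → Fin n
    τ x with block x ≟ j
    ... | yes _ = p (pred-return (r (slot x)))
    ... | no  _ = x

    τ-outside : ∀ x → block x ≢ j → τ x ≡ x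
    τ-outside x bx≢j with block x ≟ j
    ... | yes bx≡j = contradiction bx≡j bx≢j
    ... | no  _    = refl

    τ-inside : ∀ s → τ (p s) ≡ p (pred-return (r s))
    τ-inside s with block (p s) ≟ j
    ... | yes _    = cong (p ∘ pred-return ∘ r) (slot-p s)
    ... | no  bp≢j = contradiction (block-p s) bp≢j

    τ-block : ∀ x → block (τ x) ≡ block x
    τ-block x with block x ≟ j
    ... | yes bx≡j = trans (block-p (pred-return (r (slot x)))) (sym bx≡j)
    ... | no  _    = refl

    τ-injective : Injective _≡_ _≡_ τ
    τ-injective {x} {y} eq = by-cases (block x ≟ j)
      where
      bx≡by : block x ≡ block y
      bx≡by = trans (sym (τ-block x)) (trans (cong block eq) (τ-block y))

      by-cases : Dec (block x ≡ j) → x ≡ y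
      by-cases (no bx≢j) = trans (sym (τ-outside x bx≢j))
        (trans eq (τ-outside y (bx≢j ∘ trans bx≡by)))
      by-cases (yes bx≡j) = begin
        x          ≡⟨ p-slot x bx≡j ⟩
        p (slot x) ≡⟨ cong p (r-injective (pred-return-injective (p-injective (begin
            p (pred-return (r (slot x))) ≡⟨ τ-inside (slot x) ⟨
            τ (p (slot x))               ≡⟨ cong τ (p-slot x bx≡j) ⟨
            τ x                          ≡⟨ eq ⟩
            τ y                          ≡⟨ cong τ (p-slot y by≡j) ⟩
            τ (p (slot y))               ≡⟨ τ-inside (slot y) ⟩
            p (pred-return (r (slot y))) ∎)))) ⟩
        p (slot y) ≡⟨ p-slot y by≡j ⟨
        y          ∎
        where
        open ≡-Reasoning
        by≡j = trans (sym bx≡by) bx≡j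

    module Rewired = Rewire r-injective (proj₁ (proj₂ (proj₂ clash-free-cycle))) {g = f₀ ∘ ρ ∘ τ}
      (λ x x∉ → cong (f₀ ∘ ρ) (τ-outside x (λ bx≡j → x∉ (slot x , p-slot x bx≡j))))
      (λ s → cong (f₀ ∘ ρ) (τ-inside s))

    step : Arrangement j
    step = record
      { ρ           = ρ ∘ τ
      ; ρ-injective = τ-injective ∘ ρ-injective
      ; ρ-block     = λ x → trans (ρ-block (τ x)) (τ-block x)
      ; preserved   = Rewired.preserved ∘ preserved
      ; merged      = merged′
      ; separated   = separated′
      }
      where
      merged′ : ∀ {x y} → block x ≡ block y → j ≤ block x → 2 + block x * 3 < n →
                Reach (f₀ ∘ ρ ∘ τ) x y
      merged′ {x} {y} bx≡by j≤bx full′ with m≤n⇒m<n∨m≡n j≤bx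
      ... | inj₁ j<bx = Rewired.preserved (merged bx≡by j<bx full′)
      ... | inj₂ j≡bx = subst₂ (Reach (f₀ ∘ ρ ∘ τ))
        (sym (p-slot x (sym j≡bx))) (sym (p-slot y (sym (trans j≡bx bx≡by)))) (Rewired.merged (slot x) (slot y))

      separated′ : ∀ {x y} → toℕ y ≡ suc (toℕ x) → block x ≢ block y → j ≤ block x →
                   letter (ρ (τ x)) ≢ letter (ρ (τ y))
      separated′ {x} {y} y≡1+x bx≢by j≤bx with m≤n⇒m<n∨m≡n j≤bx
      ... | inj₁ j<bx
        rewrite τ-outside x (<⇒≢ j<bx ∘ sym)
              | τ-outside y (<⇒≢ (<-≤-trans j<bx
                  (/-monoˡ-≤ 3 (≤-trans (n≤1+n (toℕ x)) (≤-reflexive (sym y≡1+x))))) ∘ sym)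
        = separated y≡1+x bx≢by j<bx
      -- The boundary right after block `j`: `x` is its last position, whose letter was controlled
      -- by `clash-free-cycle`, and `y` is not moved by `τ`.
      ... | inj₂ refl
        rewrite τ-outside y (bx≢by ∘ sym) =
        subst (λ x → letter (ρ x) ≢ letter (ρ y)) (sym τx≡)
          (proj₂ (proj₂ (proj₂ clash-free-cycle)) y (trans y≡1+x (cong suc last)))
        where
        last : toℕ x ≡ 2 + j * 3
        last = block-boundary y≡1+x bx≢by
        τx≡ : τ x ≡ p (pred-return (r 2F))
        τx≡ = trans (cong τ (Fin.toℕ-injective (trans last (sym (toℕ-p _))))) (τ-inside _)

  -- Block numbers are below `n`, so no block counts as treated yet.
  initial : Arrangement n
  initial = record
    { ρ           = id
    ; ρ-injective = id
    ; ρ-block     = λ _ → refl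
    ; preserved   = id
    ; merged      = λ {x} _ n≤bx _ → contradiction n≤bx (<⇒≱ (block<n x))
    ; separated   = λ {x} _ _ n≤bx → contradiction n≤bx (<⇒≱ (block<n x))
    }
    where
    block<n : ∀ x → block x < n
    block<n x = ≤-<-trans (m/n≤m (toℕ x) 3) (Fin.toℕ<n x)

  -- An incomplete block owes nothing: `merged` concerns complete blocks only, and a block with a
  -- right neighbour is complete.
  skip : ∀ {j} → Arrangement (suc j) → ¬ 2 + j * 3 < n → Arrangement j
  skip {j} arr ¬full = record
    { ρ           = ρ
    ; ρ-injective = ρ-injective
    ; ρ-block     = ρ-block
    ; preserved   = preserved
    ; merged      = λ bx≡by j≤bx full → merged bx≡by (above j≤bx full) full
    ; separated   = λ {x} y≡1+x bx≢by j≤bx → separated y≡1+x bx≢by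
        (above j≤bx (subst (_< n) (block-boundary y≡1+x bx≢by) (Fin.toℕ<n x)))
    }
    where
    open Arrangement arr
    above : ∀ {q} → j ≤ q → 2 + q * 3 < n → j < q
    above j≤q full = ≤∧≢⇒< j≤q λ { refl → ¬full full }

  arrange : ∀ j → Arrangement j → Arrangement 0
  arrange zero    arr = arr
  arrange (suc j) arr with 2 + j * 3 <? n
  ... | yes full  = arrange j (Step.step arr full)
  ... | no  ¬full = arrange j (skip arr ¬full)

  -- The final word and its permutation

  open Arrangement (arrange n initial)

  v : Fin n → Fin k
  v = letter ∘ ρ

  f : Fin n → Fin n
  f = f₀ ∘ ρ

  -- The letters within a block are distinct, so equal letters lie in different blocks. Since `ρ`
  -- keeps every block in place, it keeps the order of equal letters.
  standard : StandardPermutation v f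
  standard x y (inj₁ vx<vy)         = standard₀ (ρ x) (ρ y) (inj₁ vx<vy)
  standard x y (inj₂ (vx≡vy , x<y)) = standard₀ (ρ x) (ρ y) (inj₂ (vx≡vy , ρx<ρy))
    where
    bx<by : block x < block y
    bx<by = ≤∧≢⇒< (/-monoˡ-≤ 3 (<⇒≤ x<y)) λ bx≡by → Fin.<⇒≢ x<y
      (ρ-injective (letter-block-injective vx≡vy (trans (ρ-block x) (trans bx≡by (sym (ρ-block y))))))
    ρx<ρy : ρ x Fin.< ρ y
    ρx<ρy = ≰⇒> λ ρy≤ρx → <⇒≱ bx<by
      (subst₂ _≤_ (ρ-block y) (ρ-block x) (/-monoˡ-≤ 3 ρy≤ρx))

  v-adjacent : ∀ x y → toℕ y ≡ suc (toℕ x) → v x ≢ v y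
  v-adjacent x y y≡1+x with block x ≟ block y
  ... | no  bx≢by = separated y≡1+x bx≢by z≤n
  ... | yes bx≡by = λ vx≡vy → <⇒≢ (≤-reflexive (sym y≡1+x)) (cong toℕ
    (ρ-injective (letter-block-injective vx≡vy (trans (ρ-block x) (trans bx≡by (sym (ρ-block y)))))))

  -- Induction on the bound `m` shows that every position reaches `z`, and symmetry of orbits turns
  -- the paths round. In `via`, `y` is a point reachable from `x` whose rank lies below `x`.
  connected : n ≢ 2 → {z : Fin n} → toℕ z ≡ 0 → ∀ x → Reach f z x
  connected n≢2 {z} z≡0 x = reach-sym (Inversion.injective standard) (descend (toℕ x) x ≤-refl)
    where
    descend : ∀ m x → toℕ x ≤ m → Reach f x z
    via : ∀ m x y → toℕ x ≤ m → 0 < toℕ x → Reach f x y → rank n (toℕ y) < toℕ x → Reach f x z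

    descend m x x≤m with 0 <? toℕ x
    ... | no  ≯0 = subst (Reach f x) (Fin.toℕ-injective (trans (n≤0⇒n≡0 (≮⇒≥ ≯0)) (sym z≡0))) reach-refl
    ... | yes 0<x with 2 + block x * 3 <? n
    ...   | no  ¬full = via m x x x≤m 0<x reach-refl (rank-descends n≢2 (Fin.toℕ<n x) 0<x (≮⇒≥ ¬full))
    ...   | yes full  = via m x y x≤m 0<x (merged (sym block-y) z≤n full) lt
      where
      y = fromℕ< (≤-<-trans (m≤n+m (block x * 3) 2) full)
      toℕ-y : toℕ y ≡ 0 + block x * 3
      toℕ-y = Fin.toℕ-fromℕ< _
      block-y : block y ≡ block x
      block-y = trans (cong (_/ 3) toℕ-y) ([s+q*3]/3 (block x) z<s)
      lt : rank n (toℕ y) < toℕ x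
      -- At remainder 0 the offset vanishes and the rank is `block x`, so what remains is
      -- `x / 3 < x`.
      lt rewrite block-y | toℕ-y | [s+q*3]%3 {0} (block x) z<s = m/n<m (toℕ x) 3 {{>-nonZero 0<x}} {{_}} (s<s z<s)

    via zero    x y x≤m 0<x x⇝y lt = contradiction x≤m (<⇒≱ 0<x)
    -- The descent from `y` is a step of `f₀`, not of `f`; `preserved` supplies an `f`-path in its
    -- place.
    via (suc m) x y x≤m 0<x x⇝y lt = reach-trans
      (reach-trans x⇝y (preserved (reach-step refl)))
      (descend m (f₀ y) (s≤s⁻¹ (≤-trans (subst (_< toℕ x) (sym (toℕ-f₀ y)) lt) x≤m)))

theorem15 : (n k : ℕ) → n > 0 → k ≥ 3 →
    ∃ λ (u : Setoid.Carrier (Necklace k n)) → CompletelyUnclustered k n u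
theorem15 n@(suc _) k n>0 k≥3 with n ≟ 2
-- The standard permutation of `01` fixes both positions, so inversion fails here. The word `01` is
-- checked by computation: its transform is `10`.
theorem15 n (suc (suc _)) _ _ | yes refl =
  0F Vec.∷ 1F Vec.∷ Vec.[] , refl
... | no n≢2 = row n 0F , unclustered (connected n≢2 refl) v-adjacent
  where
  open Arrangements n k k≥3
  open Inversion standard
theorem15 _ 1 _ (s≤s ()) | yes _
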